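{- Let $G\colon\mathbf{Set}\to\mathbf{Set}$ be a functor, $\gamma\colon X\to GX$ a $G$-coalgebra, $M=(M_n)_{n\in\mathbb{N}}$ an $(\mathbb{N},+,0)$-graded monad on $\mathbf{Set}$, and $\alpha\colon G\to M_1$ a natural transformation (i.e. $(M,\alpha)$ is a graded semantics for $G$). Then $(\gamma,\alpha)$ extends uniquely to a graded coalgebra $(\gamma_n\colon X\to G^nX)_{n\in\mathbb{N}}$ for the $(\mathbb{N},+,0)$-graded monad $(G^n)_{n\in\mathbb{N}}$ together with a graded monad morphism $(\alpha^n\colon G^n\to M_n)_{n\in\mathbb{N}}$; that is, there are a unique such graded coalgebra with $\gamma_1=\gamma$ and a unique such graded monad morphism with $\alpha^1=\alpha$.
   Context: A monad $M$ graded by a monoid $(T,\cdot,e)$ consists of endofunctors $M_t$ ($t\in T$), natural transformations $\mu^{s,t}\colon M_sM_t\to M_{s\cdot t}$ and $\eta\colon\mathrm{Id}\to M_e$ such that $\mu^{r,s\cdot t}\circ M_r\mu^{s,t}=\mu^{r\cdot s,t}\circ\mu^{r,s}M_t$ and $\mu^{t,e}\circ M_t\eta=\mathrm{id}=\mu^{e,t}\circ\eta M_t$. The graded monad $(G^n)_{n\in\mathbb{N}}$ has as multiplications and unit the identities $G^mG^n=G^{m+n}$ and $\mathrm{Id}=G^0$. A graded coalgebra of $M$ is an object $X$ with morphisms $\gamma_t\colon X\to M_tX$ such that $\gamma_e=\eta_X$ and $\gamma_{s\cdot t}=\mu^{s,t}_X\circ M_s\gamma_t\circ\gamma_s$. A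 graded monad morphism $\alpha\colon M\to N$ between $T$-graded monads is a family of natural transformations $\alpha^t\colon M_t\to N_t$ with $\alpha^{s\cdot t}\circ\mu^{s,t}=\mu^{s,t}\circ(\alpha^s\star\alpha^t)$ and $\alpha^e\circ\eta=\eta$, where $\star$ is the horizontal composition of natural transformations. -}

module Defs where

open import Level using (Level; suc; _⊔_)
open import Function.Base using (id; _∘_)
open import Data.Nat.Base using (ℕ; zero; _+_) renaming (suc to 1+)
open import Data.Nat.Properties using (+-assoc; +-identityʳ; +-0-isMonoid)
open import Algebra.Core using (Op₂)
open import Algebra.Structures using (IsMonoid)
open import Axiom.UniquenessOfIdentityProofs.WithK using (uip)
open import Relation.Binary.PropositionalEquality

private
  variable
    ℓ t : Level

-- Endofunctors of the category of types in Set ℓ and functions. Equality of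
-- functions is extensional (_≗_), so F₁ is required to respect it; in classical
-- Set this condition holds automatically.

record Functor (ℓ : Level) : Set (suc ℓ) where
  field
    F₀       : Set ℓ → Set ℓ
    F₁       : ∀ {A B} → (A → B) → F₀ A → F₀ B
    F-id     : ∀ {A} → F₁ (id {A = A}) ≗ id
    F-∘      : ∀ {A B C} (g : B → C) (f : A → B) → F₁ (g ∘ f) ≗ F₁ g ∘ F₁ f
    F-resp-≗ : ∀ {A B} {f g : A → B} → f ≗ g → F₁ f ≗ F₁ g

open Functor

Id : Functor ℓ
Id .F₀ A          = A
Id .F₁ f          = f
Id .F-id _        = refl
Id .F-∘ _ _ _     = refl
Id .F-resp-≗ f≗g  = f≗g

infixr 9 _∘F_

_∘F_ : Functor ℓ → Functor ℓ → Functor ℓ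
(F ∘F G) .F₀ A         = F₀ F (F₀ G A)
(F ∘F G) .F₁ f         = F₁ F (F₁ G f)
(F ∘F G) .F-id x       = trans (F-resp-≗ F (F-id G) x) (F-id F x)
(F ∘F G) .F-∘ g f x    = trans (F-resp-≗ F (F-∘ G g f) x) (F-∘ F (F₁ G g) (F₁ G f) x)
(F ∘F G) .F-resp-≗ f≗g = F-resp-≗ F (F-resp-≗ G f≗g)

record NatTrans (F G : Functor ℓ) : Set (suc ℓ) where
  field
    at      : ∀ A → F₀ F A → F₀ G A
    natural : ∀ {A B} (f : A → B) → at B ∘ F₁ F f ≗ F₁ G f ∘ at A

open NatTrans

infixr 8 _⋆_

_⋆_ : {F F′ G G′ : Functor ℓ} →
      NatTrans F G → NatTrans F′ G′ → NatTrans (F ∘F F′) (G ∘F G′)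
_⋆_ {F = F} {F′} {G} {G′} α β = record
  { at      = λ A → at α (F₀ G′ A) ∘ F₁ F (at β A)
  ; natural = λ {A} {B} f x → begin
      at α _ (F₁ F (at β B) (F₁ F (F₁ F′ f) x))   ≡⟨ cong (at α _) (F-∘ F _ _ x) ⟨
      at α _ (F₁ F (at β B ∘ F₁ F′ f) x)          ≡⟨ cong (at α _) (F-resp-≗ F (natural β f) x) ⟩
      at α _ (F₁ F (F₁ G′ f ∘ at β A) x)          ≡⟨ cong (at α _) (F-∘ F _ _ x) ⟩
      at α _ (F₁ F (F₁ G′ f) (F₁ F (at β A) x))   ≡⟨ natural α (F₁ G′ f) _ ⟩
      F₁ G (F₁ G′ f) (at α _ (F₁ F (at β A) x))   ∎
  }
  where open ≡-Reasoning

-- The two sides of each monoid law on grades are in general only propositionally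
-- equal, so the equations below are stated after transport along that law.

module _ {T : Set t} {_·_ : Op₂ T} {e : T} where

  record GradedMonad (ℓ : Level) (isMonoid : IsMonoid _≡_ _·_ e) : Set (t ⊔ suc ℓ) where
    open IsMonoid isMonoid using (assoc; identityˡ; identityʳ)
    field
      M : T → Functor ℓ
      μ : ∀ s t → NatTrans (M s ∘F M t) (M (s · t))
      η : NatTrans Id (M e)

    coerce : ∀ {s t A} → s ≡ t → F₀ (M s) A → F₀ (M t) A
    coerce {A = A} = subst (λ u → F₀ (M u) A)

    field
      μ-assoc : ∀ r s t A →
        at (μ r (s · t)) A ∘ F₁ (M r) (at (μ s t) A)
          ≗ coerce (assoc r s t) ∘ at (μ (r · s) t) A ∘ at (μ r s) (F₀ (M t) A)
      μ-unitʳ : ∀ t A →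
        coerce (identityʳ t) ∘ at (μ t e) A ∘ F₁ (M t) (at η A) ≗ id
      μ-unitˡ : ∀ t A →
        coerce (identityˡ t) ∘ at (μ e t) A ∘ at η (F₀ (M t) A) ≗ id

  module _ {isMonoid : IsMonoid _≡_ _·_ e} where

    record GradedCoalgebra (ℳ : GradedMonad ℓ isMonoid) (X : Set ℓ) : Set (t ⊔ ℓ) where
      open GradedMonad ℳ
      field
        str   : ∀ t → X → F₀ (M t) X
        str-e : str e ≗ at η X
        str-· : ∀ s t → str (s · t) ≗ at (μ s t) X ∘ F₁ (M s) (str t) ∘ str s

    record GradedMonadMorphism (ℳ 𝒩 : GradedMonad ℓ isMonoid) : Set (t ⊔ suc ℓ) where
      private
        module M = GradedMonad ℳ
        module N = GradedMonad 𝒩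
      field
        mor   : ∀ t → NatTrans (M.M t) (N.M t)
        mor-μ : ∀ s t A →
          at (mor (s · t)) A ∘ at (M.μ s t) A ≗ at (N.μ s t) A ∘ at (mor s ⋆ mor t) A
        mor-η : ∀ A → at (mor e) A ∘ at M.η A ≗ at N.η A

    _≈ᶜ_ : {ℳ : GradedMonad ℓ isMonoid} {X : Set ℓ} (γ δ : GradedCoalgebra ℳ X) → Set (t ⊔ ℓ)
    γ ≈ᶜ δ = ∀ t → GradedCoalgebra.str γ t ≗ GradedCoalgebra.str δ t

    _≈ᵐ_ : {ℳ 𝒩 : GradedMonad ℓ isMonoid} (α β : GradedMonadMorphism ℳ 𝒩) → Set (t ⊔ suc ℓ)
    α ≈ᵐ β = ∀ t A → at (GradedMonadMorphism.mor α t) A ≗ at (GradedMonadMorphism.mor β t) A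

infixr 10 _^F_

_^F_ : Functor ℓ → ℕ → Functor ℓ
G ^F zero = Id
G ^F 1+ n = G ∘F (G ^F n)

^F-+ : (G : Functor ℓ) (m n : ℕ) (A : Set ℓ) → F₀ (G ^F m) (F₀ (G ^F n) A) ≡ F₀ (G ^F (m + n)) A
^F-+ G zero   n A = refl
^F-+ G (1+ m) n A = cong (F₀ G) (^F-+ G m n A)

private

  cast-F₁ : (F : Functor ℓ) {A B : Set ℓ} (p : A ≡ B) → F₁ F (subst id p) ≗ subst id (cong (F₀ F) p)
  cast-F₁ F refl = F-id F

  cast-unique : {A B C : Set ℓ} (p : A ≡ B) (q : B ≡ C) (r : A ≡ C) → subst id q ∘ subst id p ≗ subst id r
  cast-unique refl refl r x = cong (λ p → subst id p x) (uip refl r)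

  ^F-+-natural : (G : Functor ℓ) (m n : ℕ) {A B : Set ℓ} (f : A → B) →
    subst id (^F-+ G m n B) ∘ F₁ (G ^F m) (F₁ (G ^F n) f)
      ≗ F₁ (G ^F (m + n)) f ∘ subst id (^F-+ G m n A)
  ^F-+-natural G zero   n f x = refl
  ^F-+-natural G (1+ m) n {A} {B} f x = begin
    subst id (cong (F₀ G) (^F-+ G m n B)) y              ≡⟨ cast-F₁ G (^F-+ G m n B) y ⟨
    F₁ G (subst id (^F-+ G m n B)) y                     ≡⟨ F-∘ G _ _ x ⟨
    F₁ G (subst id (^F-+ G m n B) ∘ F₁ (G ^F m) (F₁ (G ^F n) f)) x
                                                         ≡⟨ F-resp-≗ G (^F-+-natural G m n f) x ⟩
    F₁ G (F₁ (G ^F (m + n)) f ∘ subst id (^F-+ G m n A)) x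
                                                         ≡⟨ F-∘ G _ _ x ⟩
    F₁ G (F₁ (G ^F (m + n)) f) (F₁ G (subst id (^F-+ G m n A)) x)
                                                         ≡⟨ cong (F₁ G _) (cast-F₁ G (^F-+ G m n A) x) ⟩
    F₁ G (F₁ (G ^F (m + n)) f) (subst id (cong (F₀ G) (^F-+ G m n A)) x) ∎
    where
    open ≡-Reasoning
    y = F₁ G (F₁ (G ^F m) (F₁ (G ^F n) f)) x

-- G^m G^n = G^(m+n) holds only propositionally for variable m, so the identity
-- G^m G^n → G^(m+n) is transport along ^F-+.

powers : Functor ℓ → GradedMonad ℓ +-0-isMonoid
powers G = record
  { M = G ^F_
  ; μ = λ m n → record
      { at      = λ A → subst id (^F-+ G m n A)
      ; natural = ^F-+-natural G m n
      }
  ; η = record { at = λ A → id ; natural = λ f x → refl }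
  ; μ-assoc = λ r s t A x → begin
      subst id (^F-+ G r (s + t) A) (F₁ (G ^F r) (subst id (^F-+ G s t A)) x)
        ≡⟨ cong (subst id (^F-+ G r (s + t) A)) (cast-F₁ (G ^F r) (^F-+ G s t A) x) ⟩
      subst id (^F-+ G r (s + t) A) (subst id (cong (F₀ (G ^F r)) (^F-+ G s t A)) x)
        ≡⟨ cast-unique (cong (F₀ (G ^F r)) (^F-+ G s t A)) (^F-+ G r (s + t) A) _ x ⟩
      subst id (trans (trans (^F-+ G r s _) (^F-+ G (r + s) t A)) (cong (λ u → F₀ (G ^F u) A) (+-assoc r s t))) x
        ≡⟨ cast-unique (trans (^F-+ G r s _) (^F-+ G (r + s) t A)) (cong (λ u → F₀ (G ^F u) A) (+-assoc r s t)) _ x ⟨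
      subst id (cong (λ u → F₀ (G ^F u) A) (+-assoc r s t)) (subst id (trans (^F-+ G r s _) (^F-+ G (r + s) t A)) x)
        ≡⟨ subst-∘ (+-assoc r s t) ⟨
      subst (λ u → F₀ (G ^F u) A) (+-assoc r s t) (subst id (trans (^F-+ G r s _) (^F-+ G (r + s) t A)) x)
        ≡⟨ cong (subst (λ u → F₀ (G ^F u) A) (+-assoc r s t)) (cast-unique (^F-+ G r s _) (^F-+ G (r + s) t A) _ x) ⟨
      subst (λ u → F₀ (G ^F u) A) (+-assoc r s t) (subst id (^F-+ G (r + s) t A) (subst id (^F-+ G r s _) x)) ∎
  ; μ-unitʳ = λ t A x → begin
      subst (λ u → F₀ (G ^F u) A) (+-identityʳ t) (subst id (^F-+ G t 0 A) (F₁ (G ^F t) id x))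
        ≡⟨ subst-∘ (+-identityʳ t) ⟩
      subst id (cong (λ u → F₀ (G ^F u) A) (+-identityʳ t)) (subst id (^F-+ G t 0 A) (F₁ (G ^F t) id x))
        ≡⟨ cast-unique (^F-+ G t 0 A) (cong (λ u → F₀ (G ^F u) A) (+-identityʳ t)) refl _ ⟩
      F₁ (G ^F t) id x
        ≡⟨ F-id (G ^F t) x ⟩
      x ∎
  ; μ-unitˡ = λ t A x → refl
  }
  where open ≡-Reasoning

{-# OPTIONS --safe #-}
module Submission where

open import Defs
open import Level using (Level)
open import Data.Nat.Base using (zero; suc; _+_)
open import Data.Nat.Properties using (+-0-isMonoid)
open import Data.Product using (_×_; ∃!; _,_)
open import Function.Base using (id; _∘_)
open import Relation.Binary.PropositionalEquality
  using (_≡_; _≗_; refl; sym; trans; cong; subst; module ≡-Reasoning)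

open Functor
open NatTrans
open ≡-Reasoning

-- The laws of a graded coalgebra and of a graded monad morphism at the grades 0 and
-- 1 + n read γ₀ = id, γ₁₊ₙ = Gγₙ ∘ γ₁ and α⁰ = η, α¹⁺ⁿ = μ¹ⁿ ∘ (α¹ ⋆ αⁿ). Hence the data
-- at grade 1 determine everything, and these recursions define it; the laws at
-- arbitrary grades s, t follow by induction on s.

private
  variable
    ℓ : Level
    F G H : Functor ℓ

-- The multiplication of `powers G` is transport along `^F-+`, whose value at `suc m` is
-- `cong (F₀ G)` of its value at `m`. This lemma thus lets an induction hypothesis be used under
-- `F₁ G`.
F₁-subst : (F : Functor ℓ) {A B : Set ℓ} (p : A ≡ B) →
  F₁ F (subst id p) ≗ subst id (cong (F₀ F) p)
F₁-subst F refl = F-id F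

infixr 9 _∘N_

_∘N_ : NatTrans G H → NatTrans F G → NatTrans F H
(β ∘N α) .at A        = at β A ∘ at α A
(β ∘N α) .natural f x = trans (cong (at β _) (natural α f x)) (natural β f _)

module _ (G : Functor ℓ) {X : Set ℓ} (γ : X → F₀ G X) where

  iterate : ∀ n → X → F₀ (G ^F n) X
  iterate zero    = id
  iterate (suc n) = F₁ G (iterate n) ∘ γ

  iterate-+ : ∀ m n →
    iterate (m + n) ≗ subst id (^F-+ G m n X) ∘ F₁ (G ^F m) (iterate n) ∘ iterate m
  iterate-+ zero    n x = refl
  iterate-+ (suc m) n x = begin
    F₁ G (iterate (m + n)) (γ x)
      ≡⟨ F-resp-≗ G (iterate-+ m n) (γ x) ⟩
    F₁ G (subst id p ∘ F₁ (G ^F m) (iterate n) ∘ iterate m) (γ x)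
      ≡⟨ F-∘ G _ _ (γ x) ⟩
    F₁ G (subst id p) (F₁ G (F₁ (G ^F m) (iterate n) ∘ iterate m) (γ x))
      ≡⟨ F₁-subst G p _ ⟩
    subst id (cong (F₀ G) p) (F₁ G (F₁ (G ^F m) (iterate n) ∘ iterate m) (γ x))
      ≡⟨ cong (subst id (cong (F₀ G) p)) (F-∘ G _ _ (γ x)) ⟩
    subst id (cong (F₀ G) p) (F₁ (G ^F suc m) (iterate n) (iterate (suc m) x)) ∎
    where p = ^F-+ G m n X

  iterateCoalgebra : GradedCoalgebra (powers G) X
  iterateCoalgebra = record
    { str   = iterate
    ; str-e = λ _ → refl
    ; str-· = iterate-+
    }

  iterate-unique : (δ : GradedCoalgebra (powers G) X) → GradedCoalgebra.str δ 1 ≗ γ →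
    iterateCoalgebra ≈ᶜ δ
  iterate-unique δ δ₁≗γ zero    x = sym (GradedCoalgebra.str-e δ x)
  iterate-unique δ δ₁≗γ (suc n) x = begin
    F₁ G (iterate n) (γ x)      ≡⟨ F-resp-≗ G (iterate-unique δ δ₁≗γ n) (γ x) ⟩
    F₁ G (str n) (γ x)          ≡⟨ cong (F₁ G (str n)) (δ₁≗γ x) ⟨
    -- `^F-+ G 1 n X` reduces to `refl`, so the law at grades 1 and `n` involves no transport.
    F₁ G (str n) (str 1 x)      ≡⟨ str-· 1 n x ⟨
    str (suc n) x               ∎
    where open GradedCoalgebra δ

module _ (G : Functor ℓ) (𝕄 : GradedMonad ℓ +-0-isMonoid)
         (α : NatTrans G (GradedMonad.M 𝕄 1)) where

  open GradedMonad 𝕄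

  power : ∀ n → NatTrans (G ^F n) (M n)
  power zero    = η
  power (suc n) = μ 1 n ∘N (α ⋆ power n)

  power-1 : ∀ A → at (power 1) A ≗ at α A
  power-1 A x = begin
    at (μ 1 0) A (at α (F₀ (M 0) A) (F₁ G (at η A) x)) ≡⟨ cong (at (μ 1 0) A) (natural α (at η A) x) ⟩
    -- The right unit law at the closed grade 1 has a coercion along `refl`.
    at (μ 1 0) A (F₁ (M 1) (at η A) (at α A x))        ≡⟨ μ-unitʳ 1 A (at α A x) ⟩
    at α A x                                           ∎

  -- In the inductive step, naturality of `α` moves `μ m n` past `α`, and associativity at grades 1,
  -- `m`, `n` regroups the multiplications.
  power-+ : ∀ m n A →
    at (power (m + n)) A ∘ subst id (^F-+ G m n A)
      ≗ at (μ m n) A ∘ at (power m ⋆ power n) A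
  power-+ zero    n A x = sym (μ-unitˡ n A (at (power n) A x))
  power-+ (suc m) n A x = begin
    at (μ 1 (m + n)) A (at α _ (F₁ G (at (power (m + n)) A) (subst id (cong (F₀ G) p) x)))
      ≡⟨ cong (at (μ 1 (m + n)) A ∘ at α _ ∘ F₁ G (at (power (m + n)) A)) (F₁-subst G p x) ⟨
    at (μ 1 (m + n)) A (at α _ (F₁ G (at (power (m + n)) A) (F₁ G (subst id p) x)))
      ≡⟨ cong (at (μ 1 (m + n)) A ∘ at α _) (F-∘ G _ _ x) ⟨
    at (μ 1 (m + n)) A (at α _ (F₁ G (at (power (m + n)) A ∘ subst id p) x))
      ≡⟨ cong (at (μ 1 (m + n)) A ∘ at α _) (F-resp-≗ G (power-+ m n A) x) ⟩
    at (μ 1 (m + n)) A (at α _ (F₁ G (at (μ m n) A ∘ at (power m ⋆ power n) A) x))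
      ≡⟨ cong (at (μ 1 (m + n)) A ∘ at α _) (F-∘ G _ _ x) ⟩
    at (μ 1 (m + n)) A (at α _ (F₁ G (at (μ m n) A) (F₁ G (at (power m ⋆ power n) A) x)))
      ≡⟨ cong (at (μ 1 (m + n)) A) (natural α (at (μ m n) A) _) ⟩
    at (μ 1 (m + n)) A (F₁ (M 1) (at (μ m n) A) (at α _ (F₁ G (at (power m ⋆ power n) A) x)))
      -- Associativity of addition at 1, `m`, `n` computes to `refl`, so the coercion disappears.
      ≡⟨ μ-assoc 1 m n A _ ⟩
    at (μ (suc m) n) A (at (μ 1 m) _ (at α _ (F₁ G (at (power m ⋆ power n) A) x)))
      -- Splitting off `power n` leaves `μ 1 m` after `α ⋆ power m`, which is `power (suc m)` by
      -- definition.
      ≡⟨ cong (at (μ (suc m) n) A ∘ at (μ 1 m) _ ∘ at α _) (F-∘ G _ _ x) ⟩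
    at (μ (suc m) n) A (at (power (suc m) ⋆ power n) A x) ∎
    where p = ^F-+ G m n A

  powerMorphism : GradedMonadMorphism (powers G) 𝕄
  powerMorphism = record
    { mor   = power
    ; mor-μ = power-+
    ; mor-η = λ _ _ → refl
    }

  power-unique : (β : GradedMonadMorphism (powers G) 𝕄) →
    (∀ A → at (GradedMonadMorphism.mor β 1) A ≗ at α A) → powerMorphism ≈ᵐ β
  power-unique β β¹≗α zero    A x = sym (GradedMonadMorphism.mor-η β A x)
  power-unique β β¹≗α (suc n) A x = begin
    at (μ 1 n) A (at α _ (F₁ G (at (power n) A) x))
      ≡⟨ cong (at (μ 1 n) A ∘ at α _) (F-resp-≗ G (power-unique β β¹≗α n A) x) ⟩
    at (μ 1 n) A (at α _ (F₁ G (at (mor n) A) x))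
      ≡⟨ cong (at (μ 1 n) A) (β¹≗α _ _) ⟨
    at (μ 1 n) A (at (mor 1) _ (F₁ G (at (mor n) A) x))
      ≡⟨ mor-μ 1 n A x ⟨
    at (mor (suc n)) A x ∎
    where open GradedMonadMorphism β

proposition2p16 : ∀ {ℓ} (G : Functor ℓ) (X : Set ℓ) (γ : X → Functor.F₀ G X)
    (𝕄 : GradedMonad ℓ +-0-isMonoid) (α : NatTrans G (GradedMonad.M 𝕄 1)) →
    ∃! _≈ᶜ_ (λ (γ∞ : GradedCoalgebra (powers G) X) → GradedCoalgebra.str γ∞ 1 ≗ γ)
    × ∃! _≈ᵐ_ (λ (α∞ : GradedMonadMorphism (powers G) 𝕄) → ∀ A → NatTrans.at (GradedMonadMorphism.mor α∞ 1) A ≗ NatTrans.at α A)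
proposition2p16 G X γ 𝕄 α =
    -- `iterate 1` unfolds to `F₁ G id ∘ γ`, hence the appeal to `F-id`.
    (iterateCoalgebra G γ , (λ x → F-id G (γ x)) , λ {δ} → iterate-unique G γ δ)
  , (powerMorphism G 𝕄 α , power-1 G 𝕄 α , λ {β} → power-unique G 𝕄 α β)
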